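{- Let $d$ be a positive integer and $S$ any finite set of points in $\mathbb{R}^d$ (not necessarily in general position). Then the Radon partition graph $G_T[S,2]$ is connected.
   Context: A Radon partition of a finite set $S\subset\mathbb{R}^d$ is a partition of $S$ into two nonempty disjoint parts $P_1,P_2$ (unordered) with $\operatorname{conv}(P_1)\cap\operatorname{conv}(P_2)\neq\emptyset$. For two partitions $P,P'$ of $S$, the partition distance $D(P,P')$ is the minimum number of elements of $S$ that must be removed so that $P$ and $P'$ restricted to the remaining elements coincide. The Radon partition graph $G_T[S,2]$ has as vertices all Radon partitions of $S$, with an edge between $P$ and $P'$ if and only if $D(P,P')=1$. A graph with zero or one vertex is considered connected. -}

module Defs where

open import Algebra.Bundles using (CommutativeRing)
open import Algebra.Core using (Op₁; Op₂)
open import Algebra.Definitions using (Invertible)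
import Algebra.Definitions.RawMonoid as RawMonoidDefs
open import Algebra.Structures using (IsCommutativeRing)
open import Data.Fin using (Fin)
open import Data.Fin.Subset using (Subset; Nonempty; Empty; _∈_; _∉_; _∩_; _∪_; _─_; ∣_∣; ⊤; ⊥)
open import Data.Fin.Subset.Properties using (∣⊥∣≡0)
open import Data.Nat as ℕ using (ℕ)
open import Data.Product using (∃; _×_; _,_; proj₁; proj₂)
open import Data.Sum using (_⊎_; inj₁; inj₂)
import Data.Vec.Functional as VF
open import Data.Vec.Functional.Relation.Binary.Pointwise using (Pointwise)
open import Function using (_on_)
open import Function.Definitions using (Injective)
open import Level using (Level; _⊔_; suc; 0ℓ)
open import Relation.Binary.Bundles using (Setoid)
open import Relation.Binary.Construct.Closure.ReflexiveTransitive using (Star)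
open import Relation.Binary.Core using (Rel)
open import Relation.Binary.Structures using (IsEquivalence; IsDecTotalOrder)
open import Relation.Binary.PropositionalEquality using (_≡_; refl; sym; trans; cong; subst)
open import Relation.Nullary using (¬_)
open import Relation.Unary using (Pred)

-- The real numbers are not constructed but axiomatised as a Dedekind-complete
-- ordered field, which determines them uniquely up to isomorphism.  The order
-- and equality are decidable (IsDecTotalOrder), as they are classically.
record RealField (c ℓ₁ ℓ₂ : Level) : Set (suc (c ⊔ ℓ₁ ⊔ ℓ₂)) where
  infixl 7 _*_
  infixl 6 _+_
  infix  8 -_
  infix  4 _≈_ _≤_
  field
    Carrier : Set c
    _≈_     : Rel Carrier ℓ₁
    _≤_     : Rel Carrier ℓ₂
    _+_ _*_ : Op₂ Carrier
    -_      : Op₁ Carrier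
    0# 1#   : Carrier

    isCommutativeRing : IsCommutativeRing _≈_ _+_ _*_ -_ 0# 1#
    0≉1               : ¬ 0# ≈ 1#
    ≉0⇒invertible     : ∀ x → ¬ x ≈ 0# → Invertible _≈_ 1# _*_ x

    isDecTotalOrder : IsDecTotalOrder _≈_ _≤_
    +-monoʳ-≤       : ∀ x {y z} → y ≤ z → x + y ≤ x + z
    *-nonneg        : ∀ {x y} → 0# ≤ x → 0# ≤ y → 0# ≤ x * y

  IsUpperBound : Pred Carrier (c ⊔ ℓ₁ ⊔ ℓ₂) → Pred Carrier (c ⊔ ℓ₁ ⊔ ℓ₂)
  IsUpperBound P b = ∀ x → P x → x ≤ b

  field
    complete : (P : Pred Carrier (c ⊔ ℓ₁ ⊔ ℓ₂)) → ∃ P → ∃ (IsUpperBound P) →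
               ∃ λ s → IsUpperBound P s × (∀ b → IsUpperBound P b → s ≤ b)

  commutativeRing : CommutativeRing c ℓ₁
  commutativeRing = record { isCommutativeRing = isCommutativeRing }

  open RawMonoidDefs (CommutativeRing.+-rawMonoid commutativeRing) public using (sum)

-- A simple graph whose vertices are taken up to a setoid equality.
record Graph (v e a : Level) : Set (suc (v ⊔ e ⊔ a)) where
  field
    vertices : Setoid v e
  open Setoid vertices public using () renaming (Carrier to Vertex; _≈_ to _≈ᵛ_)
  field
    Adj        : Rel Vertex a
    Adj-sym    : ∀ {P Q} → Adj P Q → Adj Q P
    Adj-irrefl : ∀ {P Q} → P ≈ᵛ Q → ¬ Adj P Q
    Adj-resp   : ∀ {P P′ Q Q′} → P ≈ᵛ P′ → Q ≈ᵛ Q′ → Adj P Q → Adj P′ Q′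

-- A walk must end at the vertex Q, i.e. at any representative Q′ of it.
-- Graphs with at most one vertex are connected, by the empty walk.
Connected : ∀ {v e a} → Graph v e a → Set (v ⊔ e ⊔ a)
Connected G = ∀ P Q → ∃ λ Q′ → Star Adj P Q′ × Q′ ≈ᵛ Q
  where open Graph G

-- Equality of {A , B} and {C , D} as unordered pairs.
infix 4 _≈ᵖ_
_≈ᵖ_ : ∀ {n} → Rel (Subset n × Subset n) 0ℓ
(A , B) ≈ᵖ (C , D) = (A ≡ C × B ≡ D) ⊎ (A ≡ D × B ≡ C)

≈ᵖ-isEquivalence : ∀ {n} → IsEquivalence (_≈ᵖ_ {n})
≈ᵖ-isEquivalence = record
  { refl  = inj₁ (refl , refl)
  ; sym   = λ { (inj₁ (p , q)) → inj₁ (sym p , sym q)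
              ; (inj₂ (p , q)) → inj₂ (sym q , sym p) }
  ; trans = λ { (inj₁ (p , q)) (inj₁ (r , s)) → inj₁ (trans p r , trans q s)
              ; (inj₁ (p , q)) (inj₂ (r , s)) → inj₂ (trans p r , trans q s)
              ; (inj₂ (p , q)) (inj₁ (r , s)) → inj₂ (trans p s , trans q r)
              ; (inj₂ (p , q)) (inj₂ (r , s)) → inj₁ (trans p s , trans q r) }
  }

module ≈ᵖ {n} = IsEquivalence (≈ᵖ-isEquivalence {n})

record Partition (n : ℕ) : Set where
  field
    part₁ part₂ : Subset n
    nonempty₁   : Nonempty part₁
    nonempty₂   : Nonempty part₂
    disjoint    : Empty (part₁ ∩ part₂)
    covers      : part₁ ∪ part₂ ≡ ⊤

  parts : Subset n × Subset n
  parts = part₁ , part₂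

restrict : ∀ {n} → Subset n → Subset n × Subset n → Subset n × Subset n
restrict R (A , B) = A ─ R , B ─ R

CoincideOff : ∀ {n} → Subset n → Partition n → Partition n → Set
CoincideOff R P Q = restrict R (Partition.parts P) ≈ᵖ restrict R (Partition.parts Q)

-- D[ P , Q ]≡ k says that k is the least number of elements whose removal
-- makes P and Q coincide.
D[_,_]≡_ : ∀ {n} → Partition n → Partition n → ℕ → Set
D[ P , Q ]≡ k = (∃ λ R → CoincideOff R P Q × ∣ R ∣ ≡ k)
              × (∀ R → CoincideOff R P Q → k ℕ.≤ ∣ R ∣)

restrict-cong : ∀ {n} (R : Subset n) {p q} → p ≈ᵖ q → restrict R p ≈ᵖ restrict R q
restrict-cong R (inj₁ (p , q)) = inj₁ (cong (_─ R) p , cong (_─ R) q)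
restrict-cong R (inj₂ (p , q)) = inj₂ (cong (_─ R) p , cong (_─ R) q)

D-sym : ∀ {n k} {P Q : Partition n} → D[ P , Q ]≡ k → D[ Q , P ]≡ k
D-sym ((R , c , e) , min) = (R , ≈ᵖ.sym c , e) , λ R′ c′ → min R′ (≈ᵖ.sym c′)

D-irrefl : ∀ {n} {P Q : Partition n} →
           Partition.parts P ≈ᵖ Partition.parts Q → ¬ D[ P , Q ]≡ 1
D-irrefl {n} eq (_ , min) with subst (1 ℕ.≤_) (∣⊥∣≡0 n) (min ⊥ (restrict-cong ⊥ eq))
... | ()

D-resp : ∀ {n k} {P P′ Q Q′ : Partition n} →
         Partition.parts P ≈ᵖ Partition.parts P′ →
         Partition.parts Q ≈ᵖ Partition.parts Q′ →
         D[ P , Q ]≡ k → D[ P′ , Q′ ]≡ k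
D-resp p q ((R , c , e) , min) =
  (R , ≈ᵖ.trans (≈ᵖ.sym (restrict-cong R p)) (≈ᵖ.trans c (restrict-cong R q)) , e) ,
  λ R′ c′ → min R′ (≈ᵖ.trans (restrict-cong R′ p) (≈ᵖ.trans c′ (≈ᵖ.sym (restrict-cong R′ q))))

module _ {c ℓ₁ ℓ₂} (ℝ : RealField c ℓ₁ ℓ₂) where
  open RealField ℝ

  Point : ℕ → Set c
  Point d = VF.Vector Carrier d

  _≋_ : ∀ {d} → Rel (Point d) ℓ₁
  _≋_ = Pointwise _≈_

  -- A finite subset of ℝᵈ, enumerated without repetition.
  record FinitePointSet (d : ℕ) : Set (c ⊔ ℓ₁) where
    field
      size     : ℕ
      point    : Fin size → Point d
      distinct : Injective _≡_ _≋_ point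

  module _ {d : ℕ} (S : FinitePointSet d) where
    open FinitePointSet S

    -- x is a convex combination of the points of S with index in A.
    InConv : Subset size → Point d → Set (c ⊔ ℓ₁ ⊔ ℓ₂)
    InConv A x = ∃ λ (w : Fin size → Carrier) →
        (∀ i → 0# ≤ w i)
      × (∀ i → i ∉ A → w i ≈ 0#)
      × sum w ≈ 1#
      × (∀ j → sum (λ i → w i * point i j) ≈ x j)

    IsRadon : Partition size → Set (c ⊔ ℓ₁ ⊔ ℓ₂)
    IsRadon P = ∃ λ x → InConv part₁ x × InConv part₂ x
      where open Partition P

    RadonPartition : Set (c ⊔ ℓ₁ ⊔ ℓ₂)
    RadonPartition = ∃ IsRadon

    RadonPartitionSetoid : Setoid (c ⊔ ℓ₁ ⊔ ℓ₂) 0ℓ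
    RadonPartitionSetoid = record
      { Carrier       = RadonPartition
      ; _≈_           = _≈ᵖ_ on λ P → Partition.parts (proj₁ P)
      ; isEquivalence = record { refl = ≈ᵖ.refl ; sym = ≈ᵖ.sym ; trans = ≈ᵖ.trans }
      }

    RadonPartitionGraph : Graph (c ⊔ ℓ₁ ⊔ ℓ₂) 0ℓ 0ℓ
    RadonPartitionGraph = record
      { vertices   = RadonPartitionSetoid
      ; Adj        = λ P Q → D[ proj₁ P , proj₁ Q ]≡ 1
      ; Adj-sym    = λ {P} {Q} → D-sym {P = proj₁ P} {Q = proj₁ Q}
      ; Adj-irrefl = λ {P} {Q} → D-irrefl {P = proj₁ P} {Q = proj₁ Q}
      ; Adj-resp   = λ {P} {P′} {Q} {Q′} →
          D-resp {P = proj₁ P} {P′ = proj₁ P′} {Q = proj₁ Q} {Q′ = proj₁ Q′}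
      }

module Submission where

-- A Radon partition is a choice of sides s i = ±1 such that some nonzero affine dependency w of the
-- points has s i · w i ≥ 0 for all i.  Any i with w i = 0 may then change sides.  To go from (s , w) to
-- (t , w′), move along the segment from w to w′ until the first time the coefficient of some i with
-- s i ≠ t i vanishes: the sides s are compatible with the dependency u reached, so i may change sides,
-- and s and t then differ in fewer places.  Should u be zero, then w and w′ are opposite, so that s and
-- − t are compatible with one dependency and differ only where it vanishes; and − t is the same
-- unordered partition as t.

open import Algebra.Bundles using (CommutativeRing)
import Algebra.Properties.Ring as RingProperties
import Algebra.Properties.Semiring.Sum as SumProperties
open import Data.Bool using (Bool; true; false; not)
open import Data.Bool.Properties using (not-involutive; not-injective; ¬-not; not-¬)
  renaming (_≟_ to _≟ᵇ_)
open import Data.Fin using (Fin; zero; suc)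
open import Data.Fin.Properties using (any?) renaming (_≟_ to _≟ᶠ_)
open import Data.Fin.Subset using (Subset; inside; outside; _∈_; _∉_; _─_; _-_; ∣_∣; ⊤; ∁; ⁅_⁆)
open import Data.Fin.Subset.Properties
  using ( x∈p∩q⁺; x∈p∩q⁻; x∈p∪q⁻; ∈⊤; x∉p⇒x∈∁p; x∈∁p⇒x∉p; ∪-inverseʳ; x∉⁅y⁆⇒x≢y; ∣⁅x⁆∣≡1; nonempty?
        ; x∈p⇒∣p-x∣<∣p∣; Empty-unique; p─⊥≡p; x∈p∧x≢y⇒x∈p-y; drop-there)
open import Data.Nat as ℕ using (ℕ; NonZero; z≤n; s≤s)
import Data.Nat.Properties as ℕₚ
open import Data.Nat.Induction using (Acc; acc; <-wellFounded)
open import Data.Product using (∃; _×_; _,_; proj₁; proj₂)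
open import Data.Sum as Sum using (_⊎_; inj₁; inj₂; reduce)
open import Data.Vec using ([]; _∷_; lookup; tabulate)
import Data.Vec.Functional as VF
open import Data.Vec.Functional.Properties using (updateAt-updates; updateAt-minimal)
open import Data.Vec.Properties using (lookup∘tabulate; []=⇒lookup; lookup⇒[]=)
open import Function using (_∘_)
open import Level using (_⊔_)
open import Relation.Binary.Construct.Closure.ReflexiveTransitive using (Star; ε; _◅_)
open import Relation.Binary.PropositionalEquality as ≡ using (_≡_; _≢_; refl; cong; cong₂; subst)
import Relation.Binary.Reasoning.Setoid as ≈-Reasoning
open import Relation.Binary.Structures using (IsDecTotalOrder)
open import Relation.Nullary using (¬_; yes; no; contradiction; ¬?; _×-dec_)
open import Relation.Nullary.Decidable using (decidable-stable)
open import Relation.Unary using (Pred; Decidable)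
open import Defs

-- Finite maxima, and subsets compared through `lookup`.

maximum : ∀ {n p r} {P : Pred (Fin n) p} {_≼_ : Fin n → Fin n → Set r} →
          Decidable P → (∀ i j → i ≼ j ⊎ j ≼ i) →
          (∀ {i j k} → P j → i ≼ j → j ≼ k → i ≼ k) →
          (∀ i → ¬ P i) ⊎ (∃ λ i → P i × ∀ j → P j → j ≼ i)
maximum {ℕ.zero}  P? total trans = inj₁ λ ()
maximum {ℕ.suc n} {_≼_ = _≼_} P? total trans
  with P? zero | maximum (P? ∘ suc) (λ i j → total (suc i) (suc j)) trans
... | no ¬p₀ | inj₁ none            = inj₁ λ { zero → ¬p₀ ; (suc i) → none i }
... | yes p₀ | inj₁ none            = inj₂ (zero , p₀ , λ
  -- Reflexivity is totality at two equal indices.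
  { zero _ → reduce (total zero zero)
  ; (suc j) p → contradiction p (none j) })
... | no ¬p₀ | inj₂ (i , pᵢ , max) = inj₂ (suc i , pᵢ , λ
  { zero p₀ → contradiction p₀ ¬p₀ ; (suc j) → max j })
... | yes p₀ | inj₂ (i , pᵢ , max) with total zero (suc i)
... | inj₁ 0≼i = inj₂ (suc i , pᵢ , λ { zero _ → 0≼i ; (suc j) → max j })
... | inj₂ i≼0 = inj₂ (zero , p₀ , λ
  { zero _ → reduce (total zero zero)
  -- Transitivity is applied only through an index satisfying `P`: ratios compared by
  -- cross-multiplication do not chain through a zero denominator.
  ; (suc j) p → trans pᵢ (max j p) i≼0 })

lookup-injective : ∀ {n} (A B : Subset n) → (∀ j → lookup A j ≡ lookup B j) → A ≡ B
lookup-injective []      []      eq = refl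
lookup-injective (_ ∷ A) (_ ∷ B) eq = cong₂ _∷_ (eq zero) (lookup-injective A B (eq ∘ suc))

─-cong : ∀ {n} (A B R : Subset n) → (∀ j → j ∉ R → lookup A j ≡ lookup B j) → A ─ R ≡ B ─ R
─-cong []      []      []            eq = refl
─-cong (_ ∷ A) (_ ∷ B) (inside  ∷ R) eq =
  cong (outside ∷_) (─-cong A B R λ j j∉R → eq (suc j) λ j∈R → j∉R (drop-there j∈R))
─-cong (_ ∷ A) (_ ∷ B) (outside ∷ R) eq =
  cong₂ _∷_ (eq zero λ ()) (─-cong A B R λ j j∉R → eq (suc j) λ j∈R → j∉R (drop-there j∈R))

-- Partitions encoded by the side of each index.

module _ {n : ℕ} where

  side : Partition n → Fin n → Bool
  side P = lookup (Partition.part₁ P)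

  -- Disjointness excludes membership in both parts and covering excludes membership in neither, so
  -- `part₁` alone determines the partition.
  side₂ : ∀ P i → lookup (Partition.part₂ P) i ≡ not (side P i)
  side₂ P i with lookup (Partition.part₁ P) i in eq₁ | lookup (Partition.part₂ P) i in eq₂
  ... | true  | false = refl
  ... | false | true  = refl
  ... | true  | true  = contradiction (i , x∈p∩q⁺ (lookup⇒[]= i _ eq₁ , lookup⇒[]= i _ eq₂)) (Partition.disjoint P)
  ... | false | false with x∈p∪q⁻ _ _ (subst (i ∈_) (≡.sym (Partition.covers P)) ∈⊤)
  ...   | inj₁ i∈₁ = contradiction (≡.trans (≡.sym ([]=⇒lookup i∈₁)) eq₁) λ ()
  ...   | inj₂ i∈₂ = contradiction (≡.trans (≡.sym ([]=⇒lookup i∈₂)) eq₂) λ ()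

  partition : (s : Fin n → Bool) → (∃ λ i → s i ≡ true) → (∃ λ i → s i ≡ false) →
              ∃ λ P → ∀ i → side P i ≡ s i
  partition s (i , sᵢ) (j , sⱼ) = record
    { part₁ = tabulate s
    ; part₂ = ∁ (tabulate s)
    ; nonempty₁ = i , i∈
    ; nonempty₂ = j , x∉p⇒x∈∁p j∉
    ; disjoint = λ { (k , k∈) → let k∈₁ , k∈₂ = x∈p∩q⁻ (tabulate s) _ k∈ in x∈∁p⇒x∉p k∈₂ k∈₁ }
    ; covers = ∪-inverseʳ (tabulate s)
    } , lookup∘tabulate s
    where
    i∈ : i ∈ tabulate s
    i∈ = lookup⇒[]= i _ (≡.trans (lookup∘tabulate s i) sᵢ)
    j∉ : j ∉ tabulate s
    j∉ j∈ = contradiction (≡.trans (≡.sym sⱼ) (≡.trans (≡.sym (lookup∘tabulate s j)) ([]=⇒lookup j∈))) λ ()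

  side-same : ∀ P Q → (∀ i → side P i ≡ side Q i) → Partition.parts P ≈ᵖ Partition.parts Q
  side-same P Q eq = inj₁ (lookup-injective _ _ eq , lookup-injective _ _ λ i →
    ≡.trans (side₂ P i) (≡.trans (cong not (eq i)) (≡.sym (side₂ Q i))))

  -- Reversing every side only exchanges the two parts, which an unordered pair does not see.
  side-opposite : ∀ P Q → (∀ i → side P i ≡ not (side Q i)) → Partition.parts P ≈ᵖ Partition.parts Q
  side-opposite P Q eq = inj₂
    ( lookup-injective _ _ (λ i → ≡.trans (eq i) (≡.sym (side₂ Q i)))
    , lookup-injective _ _ (λ i → ≡.trans (side₂ P i) (≡.trans (cong not (eq i)) (not-involutive (side Q i)))))

  -- Two disjoint nonempty parts require two indices. This lets `flip-distance` tell a single flip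
  -- from an exchange of the parts.
  other : (P : Partition n) (i : Fin n) → ∃ λ j → j ≢ i
  other P i with Partition.nonempty₁ P | Partition.nonempty₂ P
  ... | j , j∈ | k , k∈ with j ≟ᶠ i
  ...   | no  j≢i  = j , j≢i
  ...   | yes refl = k , λ { refl → Partition.disjoint P (k , x∈p∩q⁺ (j∈ , k∈)) }

  -- Removing `i` suffices. Removing nothing does not: the change at `i` rules out equal parts, and
  -- agreement at some other index rules out exchanged parts.
  flip-distance : ∀ P Q i → side P i ≢ side Q i → (∀ j → j ≢ i → side P j ≡ side Q j) → D[ P , Q ]≡ 1
  flip-distance P Q i differ agree =
    (⁅ i ⁆ , inj₁ (─-cong _ _ ⁅ i ⁆ (λ j j∉ → agree j (x∉⁅y⁆⇒x≢y j∉))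
                  , ─-cong _ _ ⁅ i ⁆ (λ j j∉ → agree₂ j (x∉⁅y⁆⇒x≢y j∉)))
           , ∣⁅x⁆∣≡1 i)
    , minimal
    where
    agree₂ : ∀ j → j ≢ i → lookup (Partition.part₂ P) j ≡ lookup (Partition.part₂ Q) j
    agree₂ j j≢i = ≡.trans (side₂ P j) (≡.trans (cong not (agree j j≢i)) (≡.sym (side₂ Q j)))

    distinct : ¬ Partition.parts P ≈ᵖ Partition.parts Q
    distinct (inj₁ (eq , _)) = differ (cong (λ A → lookup A i) eq)
    distinct (inj₂ (eq , _)) with other P i
    ... | j , j≢i = not-¬ (agree j j≢i) (≡.trans (cong (λ A → lookup A j) eq) (side₂ Q j))

    minimal : ∀ R → CoincideOff R P Q → 1 ℕ.≤ ∣ R ∣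
    minimal R c with nonempty? R
    ... | yes (k , k∈) = ℕₚ.≤-trans (s≤s z≤n) (x∈p⇒∣p-x∣<∣p∣ k∈)
    ... | no empty with Empty-unique empty
    ...   | refl = contradiction
      (Sum.map (λ (p , q) → unrestrict p , unrestrict q) (λ (p , q) → unrestrict p , unrestrict q) c) distinct
      where
      unrestrict : ∀ {A B : Subset n} → A ─ R ≡ B ─ R → A ≡ B
      unrestrict {A} {B} eq = ≡.trans (≡.sym (p─⊥≡p A)) (≡.trans eq (p─⊥≡p B))

-- Ordered field arithmetic and finite sums.

module OrderedField {c ℓ₁ ℓ₂} (ℝ : RealField c ℓ₁ ℓ₂) where

  open RealField ℝ
  open CommutativeRing commutativeRing public
    using ( setoid; ring; semiring; +-cong; +-congˡ; +-congʳ; *-congˡ; *-congʳ; -‿cong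
          ; +-comm; +-assoc; *-comm; *-assoc
          ; +-identityˡ; +-identityʳ; *-identityˡ; *-identityʳ; zeroʳ
          ; -‿inverseˡ; -‿inverseʳ; distribˡ; distribʳ)
    renaming (refl to ≈-refl; sym to ≈-sym; trans to ≈-trans)
  open RingProperties ring public
    using (-‿distribˡ-*; -‿distribʳ-*; -‿+-comm; -‿involutive; -0#≈0#; -1*x≈-x)
  open SumProperties semiring public using (sum-cong-≋; ∑-distrib-+; *-distribˡ-sum)
  open IsDecTotalOrder isDecTotalOrder public using (_≟_; total; antisym; ≤-respˡ-≈; ≤-respʳ-≈)
    renaming (refl to ≤-refl; trans to ≤-trans)
  open ≈-Reasoning setoid

  +-nonneg : ∀ {x y} → 0# ≤ x → 0# ≤ y → 0# ≤ x + y
  +-nonneg {x} 0≤x 0≤y = ≤-trans 0≤x (≤-respˡ-≈ (+-identityʳ x) (+-monoʳ-≤ x 0≤y))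

  nonpos⇒neg-nonneg : ∀ {x} → x ≤ 0# → 0# ≤ - x
  nonpos⇒neg-nonneg {x} x≤0 = ≤-respˡ-≈ (-‿inverseˡ x) (≤-respʳ-≈ (+-identityʳ (- x)) (+-monoʳ-≤ (- x) x≤0))

  neg-nonneg⇒nonpos : ∀ {x} → 0# ≤ - x → x ≤ 0#
  neg-nonneg⇒nonpos {x} 0≤-x = ≤-respˡ-≈ (+-identityʳ x) (≤-respʳ-≈ (-‿inverseʳ x) (+-monoʳ-≤ x 0≤-x))

  nonneg-antisym : ∀ {x} → 0# ≤ x → 0# ≤ - x → x ≈ 0#
  nonneg-antisym 0≤x 0≤-x = antisym (neg-nonneg⇒nonpos 0≤-x) 0≤x

  ≤⇒0≤- : ∀ {x y} → x ≤ y → 0# ≤ y + - x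
  ≤⇒0≤- {x} {y} x≤y = ≤-respˡ-≈ (-‿inverseˡ x) (≤-respʳ-≈ (+-comm (- x) y) (+-monoʳ-≤ (- x) x≤y))

  0≤-⇒≤ : ∀ {x y} → 0# ≤ y + - x → x ≤ y
  0≤-⇒≤ {x} {y} 0≤y-x = ≤-respˡ-≈ (+-identityʳ x) (≤-respʳ-≈ eq (+-monoʳ-≤ x 0≤y-x))
    where
    eq : x + (y + - x) ≈ y
    eq = begin
      x + (y + - x)  ≈⟨ +-comm x _ ⟩
      y + - x + x    ≈⟨ +-assoc y _ x ⟩
      y + (- x + x)  ≈⟨ +-congˡ (-‿inverseˡ x) ⟩
      y + 0#         ≈⟨ +-identityʳ y ⟩
      y              ∎

  x+y≈0⇒-y≈x : ∀ {x y} → x + y ≈ 0# → - y ≈ x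
  x+y≈0⇒-y≈x {x} {y} eq = begin
    - y            ≈⟨ +-identityˡ (- y) ⟨
    0# + - y       ≈⟨ +-congʳ eq ⟨
    x + y + - y    ≈⟨ +-assoc x y (- y) ⟩
    x + (y + - y)  ≈⟨ +-congˡ (-‿inverseʳ y) ⟩
    x + 0#         ≈⟨ +-identityʳ x ⟩
    x              ∎

  *-cancel-0 : ∀ {x y} → ¬ x ≈ 0# → x * y ≈ 0# → y ≈ 0#
  *-cancel-0 {x} {y} x≉0 xy≈0 with ≉0⇒invertible x x≉0
  ... | x⁻¹ , x⁻¹x≈1 , _ = begin
    y              ≈⟨ *-identityˡ y ⟨
    1# * y         ≈⟨ *-congʳ x⁻¹x≈1 ⟨
    x⁻¹ * x * y    ≈⟨ *-assoc x⁻¹ x y ⟩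
    x⁻¹ * (x * y)  ≈⟨ *-congˡ xy≈0 ⟩
    x⁻¹ * 0#       ≈⟨ zeroʳ x⁻¹ ⟩
    0#             ∎

  -- If `y ≤ 0#`, then `x * y` and its negative are both nonnegative, so the product vanishes and
  -- hence so does `y`.
  *-cancel-nonneg : ∀ {x y} → 0# ≤ x → ¬ x ≈ 0# → 0# ≤ x * y → 0# ≤ y
  *-cancel-nonneg {x} {y} 0≤x x≉0 0≤xy with total 0# y
  ... | inj₁ 0≤y = 0≤y
  ... | inj₂ y≤0 = ≤-respʳ-≈ (≈-sym (*-cancel-0 x≉0 xy≈0)) ≤-refl
    where
    xy≈0 : x * y ≈ 0#
    xy≈0 = nonneg-antisym 0≤xy (≤-respʳ-≈ (≈-sym (-‿distribʳ-* x y)) (*-nonneg 0≤x (nonpos⇒neg-nonneg y≤0)))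

  *-monoˡ-≤ : ∀ {x y z} → 0# ≤ x → y ≤ z → x * y ≤ x * z
  *-monoˡ-≤ {x} {y} {z} 0≤x y≤z = 0≤-⇒≤
    (≤-respʳ-≈ (≈-trans (distribˡ x z (- y)) (+-congˡ (≈-sym (-‿distribʳ-* x y)))) (*-nonneg 0≤x (≤⇒0≤- y≤z)))

  *-cancelˡ-≤ : ∀ {x y z} → 0# ≤ x → ¬ x ≈ 0# → x * y ≤ x * z → y ≤ z
  *-cancelˡ-≤ {x} {y} {z} 0≤x x≉0 xy≤xz = 0≤-⇒≤ (*-cancel-nonneg 0≤x x≉0
    (≤-respʳ-≈ (≈-trans (+-congˡ (-‿distribʳ-* x y)) (≈-sym (distribˡ x z (- y)))) (≤⇒0≤- xy≤xz)))

  -- To chain two ratio inequalities, scale one by `a₃` and the other by `a₁`. This exchange then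
  -- matches the middle terms and brings the common factor `a₂` to the front of the outer ones.
  *-swap : ∀ x y z → x * (y * z) ≈ z * (y * x)
  *-swap x y z = begin
    x * (y * z)  ≈⟨ *-comm x _ ⟩
    y * z * x    ≈⟨ *-congʳ (*-comm y z) ⟩
    z * y * x    ≈⟨ *-assoc z y x ⟩
    z * (y * x)  ∎

  -- b₁ * a₂ ≤ b₂ * a₁ stands for b₁ / a₁ ≤ b₂ / a₂.
  ratio-trans : ∀ {a₁ a₂ a₃ b₁ b₂ b₃} → 0# ≤ a₁ → 0# ≤ a₂ → 0# ≤ a₃ → ¬ a₂ ≈ 0# →
                b₁ * a₂ ≤ b₂ * a₁ → b₂ * a₃ ≤ b₃ * a₂ → b₁ * a₃ ≤ b₃ * a₁
  ratio-trans {a₁} {a₂} {a₃} {b₁} {b₂} {b₃} 0≤a₁ 0≤a₂ 0≤a₃ a₂≉0 p q = *-cancelˡ-≤ 0≤a₂ a₂≉0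
    (≤-respˡ-≈ (*-swap a₃ b₁ a₂)
      (≤-trans (*-monoˡ-≤ 0≤a₃ p)
        (≤-respˡ-≈ (*-swap a₁ b₂ a₃)
          (≤-respʳ-≈ (*-swap a₁ b₃ a₂) (*-monoˡ-≤ 0≤a₁ q)))))

  0≤1 : 0# ≤ 1#
  0≤1 with total 0# 1#
  ... | inj₁ 0≤1 = 0≤1
  ... | inj₂ 1≤0 = ≤-respʳ-≈ (≈-trans (-1*x≈-x (- 1#)) (-‿involutive 1#)) (*-nonneg 0≤-1 0≤-1)
    where
    0≤-1 = nonpos⇒neg-nonneg 1≤0

  sum-zero : ∀ {n} (f : Fin n → Carrier) → (∀ i → f i ≈ 0#) → sum f ≈ 0#
  sum-zero {ℕ.zero}  f f≈0 = ≈-refl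
  sum-zero {ℕ.suc n} f f≈0 = ≈-trans (+-cong (f≈0 zero) (sum-zero (f ∘ suc) (f≈0 ∘ suc))) (+-identityˡ 0#)

  sum-nonneg : ∀ {n} (f : Fin n → Carrier) → (∀ i → 0# ≤ f i) → 0# ≤ sum f
  sum-nonneg {ℕ.zero}  f 0≤f = ≤-refl
  sum-nonneg {ℕ.suc n} f 0≤f = +-nonneg (0≤f zero) (sum-nonneg (f ∘ suc) (0≤f ∘ suc))

  -- Head and tail sum are nonnegative and negatives of each other, so both vanish.
  nonneg-sum-zero : ∀ {n} (f : Fin n → Carrier) → (∀ i → 0# ≤ f i) → sum f ≈ 0# → ∀ i → f i ≈ 0#
  nonneg-sum-zero {ℕ.suc n} f 0≤f eq =
    λ { zero → head≈0 ; (suc i) → nonneg-sum-zero (f ∘ suc) (0≤f ∘ suc) tail≈0 i }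
    where
    0≤tail : 0# ≤ sum (f ∘ suc)
    0≤tail = sum-nonneg (f ∘ suc) (0≤f ∘ suc)
    head≈0 : f zero ≈ 0#
    head≈0 = nonneg-antisym (0≤f zero) (≤-respʳ-≈ (≈-sym (x+y≈0⇒-y≈x (≈-trans (+-comm _ _) eq))) 0≤tail)
    tail≈0 : sum (f ∘ suc) ≈ 0#
    tail≈0 = nonneg-antisym 0≤tail (≤-respʳ-≈ (≈-sym (x+y≈0⇒-y≈x eq)) (0≤f zero))

  sum-nonzero : ∀ {n} (f : Fin n → Carrier) → ¬ sum f ≈ 0# → ∃ λ i → ¬ f i ≈ 0#
  sum-nonzero f f≉0 with any? (λ i → ¬? (f i ≟ 0#))
  ... | yes found = found
  ... | no none = contradiction (sum-zero f λ i → decidable-stable (f i ≟ 0#) λ fᵢ≉0 → none (i , fᵢ≉0)) f≉0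

  sum-distribʳ-+ : ∀ {n} (f g q : Fin n → Carrier) →
                   sum (λ i → (f i + g i) * q i) ≈ sum (λ i → f i * q i) + sum (λ i → g i * q i)
  sum-distribʳ-+ f g q = ≈-trans (sum-cong-≋ λ i → distribʳ (q i) (f i) (g i))
    (∑-distrib-+ (λ i → f i * q i) (λ i → g i * q i))

  sum-assoc-* : ∀ {n} x (f q : Fin n → Carrier) → sum (λ i → x * f i * q i) ≈ x * sum (λ i → f i * q i)
  sum-assoc-* x f q = ≈-trans (sum-cong-≋ λ i → *-assoc x (f i) (q i)) (≈-sym (*-distribˡ-sum x (λ i → f i * q i)))

  -- Sides acting as signs, and positive and negative parts.

  infixr 8 _∙_
  _∙_ : Bool → Carrier → Carrier
  true  ∙ x = x
  false ∙ x = - x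

  ∙-zero : ∀ s {x} → x ≈ 0# → s ∙ x ≈ 0#
  ∙-zero true  eq = eq
  ∙-zero false eq = ≈-trans (-‿cong eq) -0#≈0#

  ∙-zero⁻¹ : ∀ s {x} → s ∙ x ≈ 0# → x ≈ 0#
  ∙-zero⁻¹ true  eq = eq
  ∙-zero⁻¹ false eq = ≈-trans (≈-sym (-‿involutive _)) (∙-zero false eq)

  ∙-+ : ∀ s x y → s ∙ (x + y) ≈ s ∙ x + s ∙ y
  ∙-+ true  x y = ≈-refl
  ∙-+ false x y = ≈-sym (-‿+-comm x y)

  ∙-* : ∀ s x y → s ∙ (x * y) ≈ x * s ∙ y
  ∙-* true  x y = ≈-refl
  ∙-* false x y = -‿distribʳ-* x y

  ∙-not : ∀ {s t} x → s ≢ t → s ∙ x ≈ - (t ∙ x)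
  ∙-not {true}  {true}  x s≢t = contradiction refl s≢t
  ∙-not {true}  {false} x s≢t = ≈-sym (-‿involutive x)
  ∙-not {false} {true}  x s≢t = ≈-refl
  ∙-not {false} {false} x s≢t = contradiction refl s≢t

  -- For distinct sides the two signed values are negatives of each other.
  nonneg-both⇒zero : ∀ {s t} x → s ≢ t → 0# ≤ s ∙ x → 0# ≤ t ∙ x → x ≈ 0#
  nonneg-both⇒zero {s} {t} x s≢t 0≤s 0≤t = ∙-zero⁻¹ t (nonneg-antisym 0≤t (≤-respʳ-≈ (∙-not x s≢t) 0≤s))

  -- When `0# ≤ s ∙ x`, the positive and negative parts of `x` are `keep s x` and
  -- `keep (not s) (- x)`.
  keep : Bool → Carrier → Carrier
  keep true  x = x
  keep false x = 0#

  keep-nonneg : ∀ s {x} → 0# ≤ s ∙ x → 0# ≤ keep s x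
  keep-nonneg true  0≤x = 0≤x
  keep-nonneg false _   = ≤-refl

  keep-neg-nonneg : ∀ s {x} → 0# ≤ s ∙ x → 0# ≤ keep (not s) (- x)
  keep-neg-nonneg true  _    = ≤-refl
  keep-neg-nonneg false 0≤-x = 0≤-x

  keep-split : ∀ s x → x + keep (not s) (- x) ≈ keep s x
  keep-split true  x = +-identityʳ x
  keep-split false x = -‿inverseʳ x

  keep-nonzero : ∀ s {x} → ¬ keep s x ≈ 0# → s ≡ true
  keep-nonzero true  _   = refl
  keep-nonzero false 0≉0 = contradiction ≈-refl 0≉0

-- Affine dependencies and their correspondence with Radon partitions.

module Walks {c ℓ₁ ℓ₂} (ℝ : RealField c ℓ₁ ℓ₂) {d : ℕ} (S : FinitePointSet ℝ d) where

  open RealField ℝ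
  open OrderedField ℝ
  open FinitePointSet S
  open Graph (RadonPartitionGraph ℝ S) using (Vertex; Adj)
  open ≈-Reasoning setoid

  -- Row 0 is constantly 1, so that a dependency of the lifted points is an affine dependency of S.
  lifted : Fin (ℕ.suc d) → Fin size → Carrier
  lifted m i = (1# VF.∷ point i) m

  record Dependency (w : Fin size → Carrier) : Set (c ⊔ ℓ₁) where
    field
      balanced : ∀ m → sum (λ i → w i * lifted m i) ≈ 0#
      nonzero  : ∃ λ i → ¬ w i ≈ 0#

  open Dependency

  Compatible : (Fin size → Bool) → (Fin size → Carrier) → Set ℓ₂
  Compatible s w = ∀ i → 0# ≤ s i ∙ w i

  balanced-+ : ∀ m (v w : Fin size → Carrier) →
               sum (λ i → v i * lifted m i) ≈ 0# → sum (λ i → w i * lifted m i) ≈ 0# →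
               sum (λ i → (v i + w i) * lifted m i) ≈ 0#
  balanced-+ m v w v≈0 w≈0 = ≈-trans (sum-distribʳ-+ v w (lifted m)) (≈-trans (+-cong v≈0 w≈0) (+-identityˡ 0#))

  balanced-* : ∀ m x (w : Fin size → Carrier) → sum (λ i → w i * lifted m i) ≈ 0# →
               sum (λ i → x * w i * lifted m i) ≈ 0#
  balanced-* m x w w≈0 = ≈-trans (sum-assoc-* x w (lifted m)) (≈-trans (*-congˡ w≈0) (zeroʳ x))

  -- Subtract the two convex representations of the common point: total weights cancel in row 0 and
  -- coordinates in the other rows. The supports are disjoint and `α` has sum 1, so the difference
  -- is nonzero.
  radon⇒dependency : (P : Vertex) → ∃ λ w → Dependency w × Compatible (side (proj₁ P)) w
  radon⇒dependency (P , x , (α , 0≤α , α∉ , ∑α , αx) , (β , 0≤β , β∉ , ∑β , βx)) =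
    -- Subtraction is written as scaling by `- 1#` so that `sum-assoc-*` applies.
    (λ i → α i + - 1# * β i) , record { balanced = bal ; nonzero = nz } , compat
    where
    outside₁ : ∀ i → side P i ≡ false → α i ≈ 0#
    outside₁ i sᵢ = α∉ i λ i∈ → contradiction (≡.trans (≡.sym sᵢ) ([]=⇒lookup i∈)) λ ()

    outside₂ : ∀ i → side P i ≡ true → β i ≈ 0#
    outside₂ i sᵢ = β∉ i λ i∈ → contradiction
      (≡.trans (≡.sym (≡.trans (side₂ P i) (cong not sᵢ))) ([]=⇒lookup i∈)) λ ()

    same : ∀ m → sum (λ i → α i * lifted m i) ≈ sum (λ i → β i * lifted m i)
    same zero = begin
      sum (λ i → α i * 1#)  ≈⟨ sum-cong-≋ (λ i → *-identityʳ (α i)) ⟩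
      sum α                 ≈⟨ ∑α ⟩
      1#                    ≈⟨ ∑β ⟨
      sum β                 ≈⟨ sum-cong-≋ (λ i → *-identityʳ (β i)) ⟨
      sum (λ i → β i * 1#)  ∎
    same (suc j) = ≈-trans (αx j) (≈-sym (βx j))

    bal : ∀ m → sum (λ i → (α i + - 1# * β i) * lifted m i) ≈ 0#
    bal m = begin
      sum (λ i → (α i + - 1# * β i) * lifted m i)
        ≈⟨ sum-distribʳ-+ α (λ i → - 1# * β i) (lifted m) ⟩
      sum (λ i → α i * lifted m i) + sum (λ i → - 1# * β i * lifted m i)
        ≈⟨ +-cong (same m) (≈-trans (sum-assoc-* (- 1#) β (lifted m)) (-1*x≈-x _)) ⟩
      sum (λ i → β i * lifted m i) + - sum (λ i → β i * lifted m i)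
        ≈⟨ -‿inverseʳ _ ⟩
      0# ∎

    at₁ : ∀ i → side P i ≡ true → α i + - 1# * β i ≈ α i
    at₁ i sᵢ = ≈-trans (+-congˡ (≈-trans (*-congˡ (outside₂ i sᵢ)) (zeroʳ _))) (+-identityʳ _)

    nz : ∃ λ i → ¬ α i + - 1# * β i ≈ 0#
    nz with sum-nonzero α (λ ∑α≈0 → 0≉1 (≈-trans (≈-sym ∑α≈0) ∑α))
    ... | i , αᵢ≉0 with side P i in sᵢ
    ...   | true  = i , λ eq → αᵢ≉0 (≈-trans (≈-sym (at₁ i sᵢ)) eq)
    ...   | false = contradiction (outside₁ i sᵢ) αᵢ≉0

    compat : Compatible (side P) (λ i → α i + - 1# * β i)
    compat i with side P i in sᵢ
    ... | true  = ≤-respʳ-≈ (≈-sym (at₁ i sᵢ)) (0≤α i)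
    ... | false = ≤-respʳ-≈ eq (0≤β i)
      where
      eq : β i ≈ - (α i + - 1# * β i)
      eq = begin
        β i                      ≈⟨ -‿involutive _ ⟨
        - - β i                  ≈⟨ -‿cong (-1*x≈-x _) ⟨
        - (- 1# * β i)           ≈⟨ -‿cong (+-identityˡ _) ⟨
        - (0# + - 1# * β i)      ≈⟨ -‿cong (+-congʳ (outside₁ i sᵢ)) ⟨
        - (α i + - 1# * β i)     ∎

  -- Normalisation: nonnegative weights of total `t` become convex weights after division by `t`,
  -- and the weighted sum `y` is divided along with them.
  conv : ∀ {A α t t⁻¹} {y : Point ℝ d} → t⁻¹ * t ≈ 1# → 0# ≤ t⁻¹ →
         (∀ i → 0# ≤ α i) → (∀ i → i ∉ A → α i ≈ 0#) →
         sum α ≈ t → (∀ j → sum (λ i → α i * point i j) ≈ y j) →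
         InConv ℝ S A (λ j → t⁻¹ * y j)
  conv {α = α} {t} {t⁻¹} t⁻¹t≈1 0≤t⁻¹ 0≤α α∉ ∑α αy =
    (λ i → t⁻¹ * α i)
    , (λ i → *-nonneg 0≤t⁻¹ (0≤α i))
    , (λ i i∉ → ≈-trans (*-congˡ (α∉ i i∉)) (zeroʳ t⁻¹))
    , ≈-trans (≈-sym (*-distribˡ-sum t⁻¹ α)) (≈-trans (*-congˡ ∑α) t⁻¹t≈1)
    , (λ j → ≈-trans (sum-assoc-* t⁻¹ α (λ i → point i j)) (*-congˡ (αy j)))

  module _ {s : Fin size → Bool} {w : Fin size → Carrier} (dep : Dependency w) (compat : Compatible s w) where

    pos neg : Fin size → Carrier
    pos i = keep (s i) (w i)
    neg i = keep (not (s i)) (- w i)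

    0≤pos : ∀ i → 0# ≤ pos i
    0≤pos i = keep-nonneg (s i) (compat i)

    0≤neg : ∀ i → 0# ≤ neg i
    0≤neg i = keep-neg-nonneg (s i) (compat i)

    -- Here `neg` is `pos` minus `w`, and `w` contributes zero to every row.
    same : ∀ m → sum (λ i → neg i * lifted m i) ≈ sum (λ i → pos i * lifted m i)
    same m = begin
      sum (λ i → neg i * lifted m i)
        ≈⟨ +-identityˡ _ ⟨
      0# + sum (λ i → neg i * lifted m i)
        ≈⟨ +-congʳ (balanced dep m) ⟨
      sum (λ i → w i * lifted m i) + sum (λ i → neg i * lifted m i)
        ≈⟨ sum-distribʳ-+ w neg (lifted m) ⟨
      sum (λ i → (w i + neg i) * lifted m i)
        ≈⟨ sum-cong-≋ (λ i → *-congʳ (keep-split (s i) (w i))) ⟩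
      sum (λ i → pos i * lifted m i) ∎

    ∑neg≈∑pos : sum neg ≈ sum pos
    ∑neg≈∑pos = begin
      sum neg                 ≈⟨ sum-cong-≋ (λ i → *-identityʳ (neg i)) ⟨
      sum (λ i → neg i * 1#)  ≈⟨ same zero ⟩
      sum (λ i → pos i * 1#)  ≈⟨ sum-cong-≋ (λ i → *-identityʳ (pos i)) ⟩
      sum pos                 ∎

    -- If this sum vanished, so would the equal sum of `neg`. All terms of both would then be zero,
    -- and with them `w`, their difference.
    ∑pos≉0 : ¬ sum pos ≈ 0#
    ∑pos≉0 ∑pos≈0 = let i , wᵢ≉0 = nonzero dep in wᵢ≉0 (begin
      w i          ≈⟨ +-identityʳ (w i) ⟨
      w i + 0#     ≈⟨ +-congˡ (nonneg-sum-zero neg 0≤neg (≈-trans ∑neg≈∑pos ∑pos≈0) i) ⟨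
      w i + neg i  ≈⟨ keep-split (s i) (w i) ⟩
      pos i        ≈⟨ nonneg-sum-zero pos 0≤pos ∑pos≈0 i ⟩
      0#           ∎)

    inhabited₁ : ∃ λ i → s i ≡ true
    inhabited₁ = let i , posᵢ≉0 = sum-nonzero pos ∑pos≉0 in i , keep-nonzero _ posᵢ≉0

    inhabited₂ : ∃ λ i → s i ≡ false
    inhabited₂ = let i , negᵢ≉0 = sum-nonzero neg (∑pos≉0 ∘ ≈-trans (≈-sym ∑neg≈∑pos)) in
      i , not-injective (keep-nonzero _ negᵢ≉0)

    P : Partition size
    P = proj₁ (partition s inhabited₁ inhabited₂)

    sideP : ∀ i → side P i ≡ s i
    sideP = proj₂ (partition s inhabited₁ inhabited₂)

    vanishes₁ : ∀ i → i ∉ Partition.part₁ P → pos i ≈ 0#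
    vanishes₁ i i∉ = decidable-stable (pos i ≟ 0#) λ posᵢ≉0 →
      i∉ (lookup⇒[]= i _ (≡.trans (sideP i) (keep-nonzero _ posᵢ≉0)))

    vanishes₂ : ∀ i → i ∉ Partition.part₂ P → neg i ≈ 0#
    vanishes₂ i i∉ = decidable-stable (neg i ≟ 0#) λ negᵢ≉0 →
      i∉ (lookup⇒[]= i _ (≡.trans (side₂ P i) (≡.trans (cong not (sideP i)) (keep-nonzero _ negᵢ≉0))))

    -- The positive and negative parts of `w` have the same total and the same weighted sum of
    -- points. Dividing by that total gives one point in both hulls.
    dependency⇒radon : ∃ λ (P : Vertex) → ∀ i → side (proj₁ P) i ≡ s i
    dependency⇒radon with ≉0⇒invertible (sum pos) ∑pos≉0
    ... | t⁻¹ , t⁻¹t≈1 , tt⁻¹≈1 = (P , (λ j → t⁻¹ * sum (λ i → pos i * point i j))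
        , conv t⁻¹t≈1 0≤t⁻¹ 0≤pos vanishes₁ ≈-refl (λ j → ≈-refl)
        , conv t⁻¹t≈1 0≤t⁻¹ 0≤neg vanishes₂ ∑neg≈∑pos (λ j → same (suc j))) , sideP
      where
      0≤t⁻¹ : 0# ≤ t⁻¹
      0≤t⁻¹ = *-cancel-nonneg (sum-nonneg pos 0≤pos) ∑pos≉0 (≤-respʳ-≈ (≈-sym tt⁻¹≈1) 0≤1)

  -- Flipping single indices and walking between partitions.

  flip : ∀ P {w} → Dependency w → Compatible (side (proj₁ P)) w → ∀ i → w i ≈ 0# →
         ∃ λ P′ → Adj P P′ × Compatible (side (proj₁ P′)) w ×
           side (proj₁ P′) i ≢ side (proj₁ P) i × (∀ j → j ≢ i → side (proj₁ P′) j ≡ side (proj₁ P) j)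
  flip P {w} dep compat i wᵢ≈0 =
    P′ , flip-distance (proj₁ P) (proj₁ P′) i (changed ∘ ≡.sym) (λ j j≢i → ≡.sym (kept j j≢i))
    , compat′ , changed , kept
    where
    σ s : Fin size → Bool
    σ = side (proj₁ P)
    s = VF.updateAt σ i not

    s-compat : Compatible s w
    s-compat j with j ≟ᶠ i
    ... | yes refl = ≤-respʳ-≈ (≈-sym (∙-zero (s i) wᵢ≈0)) ≤-refl
    ... | no j≢i = subst (λ b → 0# ≤ b ∙ w j) (≡.sym (updateAt-minimal j i σ j≢i)) (compat j)

    P′ : Vertex
    -- The unchanged dependency `w` certifies the new sides; in particular the flip cannot empty a
    -- part.
    P′ = proj₁ (dependency⇒radon dep s-compat)

    sideP′ : ∀ j → side (proj₁ P′) j ≡ s j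
    sideP′ = proj₂ (dependency⇒radon dep s-compat)

    compat′ : Compatible (side (proj₁ P′)) w
    compat′ j = subst (λ b → 0# ≤ b ∙ w j) (≡.sym (sideP′ j)) (s-compat j)

    changed : side (proj₁ P′) i ≢ σ i
    changed eq = not-¬ refl (≡.trans (≡.sym eq) (≡.trans (sideP′ i) (updateAt-updates i σ)))

    kept : ∀ j → j ≢ i → side (proj₁ P′) j ≡ σ j
    kept j j≢i = ≡.trans (sideP′ j) (updateAt-minimal j i σ j≢i)

  -- With only two sides, flipping `i` makes it agree with `t`. The set `D` bounds the differing
  -- indices and may therefore lose `i`; its size is the measure for the recursions below.
  flip-towards : ∀ P {w} → Dependency w → Compatible (side (proj₁ P)) w → ∀ i → w i ≈ 0# →
                 ∀ (t : Fin size → Bool) → side (proj₁ P) i ≢ t i →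
                 ∀ D → (∀ j → side (proj₁ P) j ≢ t j → j ∈ D) →
                 ∃ λ P′ → Adj P P′ × Compatible (side (proj₁ P′)) w ×
                   (∀ j → side (proj₁ P′) j ≢ t j → j ∈ D - i)
  flip-towards P dep compat i wᵢ≈0 t σᵢ≢tᵢ D covers =
    let P′ , adj , compat′ , changed , kept = flip P dep compat i wᵢ≈0 in
    P′ , adj , compat′ , λ j τⱼ≢tⱼ →
      let j≢i = λ { refl → τⱼ≢tⱼ (≡.trans (¬-not changed) (≡.sym (¬-not (σᵢ≢tᵢ ∘ ≡.sym)))) } in
      x∈p∧x≢y⇒x∈p-y (covers j (τⱼ≢tⱼ ∘ ≡.trans (kept j j≢i))) j≢i

  -- The target is given by sides, so `not ∘ t` can be a target before it is known to come from a
  -- vertex.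
  Reaches : Vertex → (Fin size → Bool) → Set _
  Reaches P t = ∃ λ P′ → Star Adj P P′ × (∀ i → side (proj₁ P′) i ≡ t i)

  prepend : ∀ {P P′ t} → Adj P P′ → Reaches P′ t → Reaches P t
  prepend adj (Q , path , eq) = Q , adj ◅ path , eq

  -- Where the sides differ, compatibility with both forces the shared coefficient to be zero, so
  -- the differing indices can be flipped one after another.
  common-dependency-walk : ∀ D → Acc ℕ._<_ ∣ D ∣ → ∀ P {w} {t : Fin size → Bool} → Dependency w →
    Compatible (side (proj₁ P)) w → Compatible t w → (∀ j → side (proj₁ P) j ≢ t j → j ∈ D) → Reaches P t
  common-dependency-walk D (acc rec) P {w} {t} dep compat compatₜ covers
    with any? (λ i → ¬? (side (proj₁ P) i ≟ᵇ t i))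
  ... | no none = P , ε , λ i → decidable-stable (_ ≟ᵇ _) λ σᵢ≢tᵢ → none (i , σᵢ≢tᵢ)
  ... | yes (i , σᵢ≢tᵢ) =
    let wᵢ≈0 = nonneg-both⇒zero (w i) σᵢ≢tᵢ (compat i) (compatₜ i)
        P′ , adj , compat′ , covers′ = flip-towards P dep compat i wᵢ≈0 t σᵢ≢tᵢ D covers
    in prepend {P} {P′} adj (common-dependency-walk (D - i)
         (rec (x∈p⇒∣p-x∣<∣p∣ (covers i σᵢ≢tᵢ))) P′ dep compat′ compatₜ covers′)

  -- The target dependency `w′` stays fixed, while `w` is replaced by the dependency reached on the
  -- segment. Each recursive call follows a flip that removes an index from `D`.
  walk : ∀ D → Acc ℕ._<_ ∣ D ∣ → ∀ P {w w′} {t : Fin size → Bool} → Dependency w → Dependency w′ →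
    Compatible (side (proj₁ P)) w → Compatible t w′ → (∀ j → side (proj₁ P) j ≢ t j → j ∈ D) →
    Reaches P t ⊎ Reaches P (not ∘ t)
  walk D (acc rec) P {w} {w′} {t} dep dep′ compat compat′ covers
    with any? (λ i → ¬? (side (proj₁ P) i ≟ᵇ t i) ×-dec w i ≟ 0#)
  ... | yes (i , σᵢ≢tᵢ , wᵢ≈0) =
    let P′ , adj , compat″ , covers′ = flip-towards P dep compat i wᵢ≈0 t σᵢ≢tᵢ D covers
    in Sum.map (prepend {P} {P′} adj) (prepend {P} {P′} adj)
         (walk (D - i) (rec (x∈p⇒∣p-x∣<∣p∣ (covers i σᵢ≢tᵢ))) P′ dep dep′ compat″ compat′ covers′)
  ... | no nonzero-differing = step
    where
    σ : Fin size → Bool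
    σ = side (proj₁ P)

    a b : Fin size → Carrier
    -- By compatibility these are the absolute values of `w i` and `w′ i`.
    a i = σ i ∙ w i
    b i = t i ∙ w′ i

    Differ : Fin size → Set
    Differ i = σ i ≢ t i

    a≉0 : ∀ {i} → Differ i → ¬ a i ≈ 0#
    a≉0 {i} σᵢ≢tᵢ aᵢ≈0 = nonzero-differing (i , σᵢ≢tᵢ , ∙-zero⁻¹ (σ i) aᵢ≈0)

    -- max says that a i / (a i + b i), the time at which the coefficient of i vanishes on the segment
    -- from w to w′, is least possible; u is the point reached, scaled by a i + b i.
    module _ (i : Fin size) (σᵢ≢tᵢ : Differ i) (max : ∀ j → Differ j → b j * a i ≤ b i * a j) where

      u : Fin size → Carrier
      u j = b i * w j + a i * w′ j

      σu : ∀ j → σ j ∙ u j ≈ b i * a j + a i * σ j ∙ w′ j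
      σu j = ≈-trans (∙-+ (σ j) _ _) (+-cong (∙-* (σ j) _ _) (∙-* (σ j) _ _))

      -- At a differing index `w′ j` counts negatively for the side `σ j`. What remains is the
      -- difference of the two cross products compared by `max`.
      σu-differ : ∀ {j} → Differ j → σ j ∙ u j ≈ b i * a j + - (b j * a i)
      σu-differ {j} σⱼ≢tⱼ = begin
        σ j ∙ u j                      ≈⟨ σu j ⟩
        b i * a j + a i * σ j ∙ w′ j   ≈⟨ +-congˡ (*-congˡ (∙-not (w′ j) σⱼ≢tⱼ)) ⟩
        b i * a j + a i * - b j        ≈⟨ +-congˡ (-‿distribʳ-* (a i) (b j)) ⟨
        b i * a j + - (a i * b j)      ≈⟨ +-congˡ (-‿cong (*-comm (a i) (b j))) ⟩
        b i * a j + - (b j * a i)      ∎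

      u-compat : Compatible σ u
      u-compat j with σ j ≟ᵇ t j
      ... | no σⱼ≢tⱼ = ≤-respʳ-≈ (≈-sym (σu-differ σⱼ≢tⱼ)) (≤⇒0≤- (max j σⱼ≢tⱼ))
      -- Where the sides agree, both dependencies contribute nonnegatively.
      ... | yes σⱼ≡tⱼ = ≤-respʳ-≈ (≈-sym (σu j)) (+-nonneg (*-nonneg (compat′ i) (compat j))
        (*-nonneg (compat i) (subst (λ s → 0# ≤ s ∙ w′ j) (≡.sym σⱼ≡tⱼ) (compat′ j))))

      uᵢ≈0 : u i ≈ 0#
      uᵢ≈0 = ∙-zero⁻¹ (σ i) (≈-trans (σu-differ σᵢ≢tᵢ) (-‿inverseʳ _))

      u-balanced : ∀ m → sum (λ j → u j * lifted m j) ≈ 0#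
      u-balanced m = balanced-+ m _ _ (balanced-* m (b i) w (balanced dep m)) (balanced-* m (a i) w′ (balanced dep′ m))

      opposite : (∀ j → u j ≈ 0#) → Reaches P (not ∘ t)
      -- The set `D` bounds the differences from `t`, not from `not ∘ t`, so the walk starts afresh
      -- with the full set.
      opposite u≈0 = common-dependency-walk ⊤ (<-wellFounded _) P z-dep z-compat z-compat′ (λ _ _ → ∈⊤)
        where
        z : Fin size → Carrier
        -- Since `u` vanishes, this is also `b i * w j`. Written through `w′`, it is nonzero because
        -- `a i` and some `w′ j` are.
        z j = - a i * w′ j

        -a≉0 : ¬ - a i ≈ 0#
        -a≉0 = a≉0 σᵢ≢tᵢ ∘ ∙-zero⁻¹ false

        z-dep : Dependency z
        z-dep = record
          { balanced = λ m → balanced-* m (- a i) w′ (balanced dep′ m)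
          ; nonzero = let j , w′ⱼ≉0 = nonzero dep′ in j , w′ⱼ≉0 ∘ *-cancel-0 -a≉0
          }

        z-compat : Compatible σ z
        z-compat j = ≤-respʳ-≈ (begin
          b i * a j              ≈⟨ x+y≈0⇒-y≈x (≈-trans (≈-sym (σu j)) (∙-zero (σ j) (u≈0 j))) ⟨
          - (a i * σ j ∙ w′ j)   ≈⟨ -‿distribˡ-* (a i) _ ⟩
          - a i * σ j ∙ w′ j     ≈⟨ ∙-* (σ j) (- a i) (w′ j) ⟨
          σ j ∙ z j              ∎) (*-nonneg (compat′ i) (compat j))

        z-compat′ : Compatible (not ∘ t) z
        z-compat′ j = ≤-respʳ-≈ (begin
          a i * b j              ≈⟨ -‿involutive _ ⟨
          - - (a i * b j)        ≈⟨ -‿cong (-‿distribˡ-* (a i) (b j)) ⟩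
          - (- a i * b j)        ≈⟨ -‿cong (∙-* (t j) (- a i) (w′ j)) ⟨
          - (t j ∙ z j)          ≈⟨ ∙-not {not (t j)} {t j} (z j) (not-¬ refl ∘ ≡.sym) ⟨
          not (t j) ∙ z j        ∎) (*-nonneg (compat i) (compat′ j))

      step-at : Reaches P t ⊎ Reaches P (not ∘ t)
      step-at with any? (λ j → ¬? (u j ≟ 0#))
      ... | no none = inj₂ (opposite λ j → decidable-stable (u j ≟ 0#) λ uⱼ≉0 → none (j , uⱼ≉0))
      ... | yes u-nonzero =
        let u-dep = record { balanced = u-balanced ; nonzero = u-nonzero }
            P′ , adj , compat″ , covers′ = flip-towards P u-dep u-compat i uᵢ≈0 t σᵢ≢tᵢ D covers
        in Sum.map (prepend {P} {P′} adj) (prepend {P} {P′} adj)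
             (walk (D - i) (rec (x∈p⇒∣p-x∣<∣p∣ (covers i σᵢ≢tᵢ))) P′ u-dep dep′ compat″ compat′ covers′)

    step : Reaches P t ⊎ Reaches P (not ∘ t)
    -- The order compares the ratios `b i / a i`; the largest ratio has the earliest vanishing time.
    step with maximum {P = Differ} {_≼_ = λ i j → b i * a j ≤ b j * a i}
                (λ i → ¬? (σ i ≟ᵇ t i)) (λ i j → total _ _)
                (λ {i} {j} {k} σⱼ≢tⱼ → ratio-trans (compat i) (compat j) (compat k) (a≉0 σⱼ≢tⱼ))
    ... | inj₁ none = inj₁ (P , ε , λ i → decidable-stable (_ ≟ᵇ _) (none i))
    ... | inj₂ (i , σᵢ≢tᵢ , max) = step-at i σᵢ≢tᵢ max

  connected : Connected (RadonPartitionGraph ℝ S)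
  connected P Q with radon⇒dependency P | radon⇒dependency Q
  ... | w , dep , compat | w′ , dep′ , compat′
    with walk ⊤ (<-wellFounded _) P dep dep′ compat compat′ (λ _ _ → ∈⊤)
  ... | inj₁ (P′ , path , eq) = P′ , path , side-same (proj₁ P′) (proj₁ Q) eq
  ... | inj₂ (P′ , path , eq) = P′ , path , side-opposite (proj₁ P′) (proj₁ Q) eq

theorem4p1 : ∀ {c ℓ₁ ℓ₂} (ℝ : RealField c ℓ₁ ℓ₂) (d : ℕ) .{{_ : NonZero d}} (S : FinitePointSet ℝ d) → Connected (RadonPartitionGraph ℝ S)
theorem4p1 ℝ d S = Walks.connected ℝ S
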